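{- For almost all graphs $G$, $md(G)=1$ holds. That is, if $G$ is a random graph on $n$ labelled vertices in which each pair of vertices is chosen as an edge independently with probability $\frac12$, then the probability that $G$ is connected and $md(G)=1$ tends to $1$ as $n\to\infty$.
   Context: Graphs are finite and simple. An edge-coloring of a graph $G$ is an arbitrary map from $E(G)$ to a finite set of colors (adjacent edges may receive the same color). For two distinct vertices $u,v$ of an edge-colored graph $G$, a monochromatic $uv$-cut is a set $M$ of edges, all of the same color, such that $u$ and $v$ lie in different components of $G-M$. An edge-coloring of $G$ is an $MD$-coloring (monochromatic disconnection coloring) if every two distinct vertices of $G$ are separated by a monochromatic cut. For a connected graph $G$, the monochromatic disconnection number $md(G)$ is the maximum number of colors actually used on $E(G)$ over all $MD$-colorings of $G$. "Almost all graphs" is understood with respect to the random graph model $\mathcal{G}_{n,1/2}$ as $n\to\infty$. -}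

module Defs where

open import Level using (0ℓ)
open import Data.Bool.Base using (Bool; true; false; T; if_then_else_)
open import Data.Bool.Properties using (T-irrelevant)
open import Data.Empty using (⊥-elim)
open import Data.Unit.Base using (tt)
open import Data.Fin.Base using (Fin; zero; suc; combine; _<_)
open import Data.Fin.Properties
  using (_≟_; _<?_; any?; all?; <-irrelevant; combine-injective)
open import Data.Fin.Subset using (Subset; ∣_∣; _∈_; _⊆_; ⊥; ⁅_⁆; _-_)
open import Data.Fin.Subset.Properties
  using ( nonempty?; anySubset?; Empty-unique; ∣⊥∣≡0; ∣⁅x⁆∣≡1; x∈⁅x⁆
        ; p⊆q⇒∣p∣≤∣q∣; x∈p∧x≢y⇒x∈p-y; x∈p⇒∣p-x∣<∣p∣; x∈⁅y⁆⇒x≡y)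
open import Data.Integer.Base using (+_)
open import Data.List.Base
  using (List; []; _∷_; [_]; length; filter; allFin; cartesianProductWith)
open import Data.List.Membership.Propositional using () renaming (_∈_ to _∈ˡ_)
open import Data.List.Membership.Propositional.Properties using (∈-allFin)
open import Data.List.Relation.Unary.Any using (here; there)
open import Data.Nat.Base as ℕ using (ℕ; NonZero)
import Data.Nat.Properties as ℕ
open import Data.Product.Base using (Σ; ∃; ∃-syntax; _×_; _,_; proj₁; proj₂)
open import Data.Rational.Base as ℚ using (ℚ; 0ℚ; _/_)
open import Data.Sum.Base using (_⊎_; inj₁; inj₂)
open import Data.Vec.Base using (Vec; []; _∷_; lookup; tabulate)
open import Data.Vec.Properties using (lookup∘tabulate; []=⇒lookup; lookup⇒[]=)
open import Function.Base using (_∘_)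
open import Relation.Binary.Construct.Closure.ReflexiveTransitive
  using (Star; ε; _◅_; _◅◅_) renaming (map to Star-map)
open import Relation.Binary.Core using (Rel)
open import Relation.Binary.Definitions using (Decidable)
open import Relation.Binary.PropositionalEquality
  using (_≡_; _≢_; refl; sym; trans; cong; subst)
open import Relation.Nullary.Decidable
  using (Dec; yes; no; does; map′; ¬?; T?; _×-dec_; _⊎-dec_; _→-dec_; dec-true; dec-false)
open import Relation.Nullary.Negation using (¬_; contradiction)

record SimpleGraph (n : ℕ) : Set where
  field
    adj        : Fin n → Fin n → Bool
    adj-sym    : ∀ u v → adj u v ≡ adj v u
    adj-irrefl : ∀ u → adj u u ≡ false

  Adj : Rel (Fin n) 0ℓ
  Adj u v = T (adj u v)

open SimpleGraph public using (Adj)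

private variable
  n k m : ℕ
  G : SimpleGraph n

Connected : SimpleGraph n → Set
Connected G = ∀ u v → Star (Adj G) u v

-- An unordered pair {u , v} is represented by its increasing arrangement, so
-- a function on Edge G is an arbitrary function on E(G).
record Edge (G : SimpleGraph n) : Set where
  constructor edge
  field
    src tgt  : Fin n
    src<tgt  : src < tgt
    adjacent : Adj G src tgt

open Edge public

Joins : Edge G → Rel (Fin _) 0ℓ
Joins e u v = (src e ≡ u × tgt e ≡ v) ⊎ (src e ≡ v × tgt e ≡ u)

EdgeSet : SimpleGraph n → Set
EdgeSet G = Edge G → Bool

_∈ᴱ_ : Edge G → EdgeSet G → Set
e ∈ᴱ M = T (M e)

-- Adjacency in the spanning subgraph G − M.
AdjAvoiding : (G : SimpleGraph n) → EdgeSet G → Rel (Fin n) 0ℓ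
AdjAvoiding G M u v = ∃[ e ] (Joins {G = G} e u v × ¬ (e ∈ᴱ M))

-- u and v lie in different components of G − M.
Separates : (G : SimpleGraph n) → EdgeSet G → Fin n → Fin n → Set
Separates G M u v = ¬ Star (AdjAvoiding G M) u v

-- Colors are drawn from a palette Fin k; not all of them need be used.
Coloring : SimpleGraph n → ℕ → Set
Coloring G k = Edge G → Fin k

Monochromatic : Coloring G k → EdgeSet G → Set
Monochromatic c M = ∀ e f → e ∈ᴱ M → f ∈ᴱ M → c e ≡ c f

IsMDColoring : (G : SimpleGraph n) → Coloring G k → Set
IsMDColoring G c =
  ∀ u v → u ≢ v → Σ (EdgeSet G) λ M → Monochromatic c M × Separates G M u v

edge-≡ : {e f : Edge G} → src e ≡ src f → tgt e ≡ tgt f → e ≡ f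
edge-≡ {e = edge u v p a} {f = edge _ _ q b} refl refl
  rewrite <-irrelevant p q | T-irrelevant a b = refl

anyEdge? : {P : Edge G → Set} → (∀ e → Dec (P e)) → Dec (∃ P)
anyEdge? {G = G} {P} P? =
  map′ (λ { (u , v , p , a , Pe) → edge u v p a , Pe })
       (λ { (edge u v p a , Pe) → u , v , p , a , Pe })
       (any? λ u → any? λ v → at u v)
  where
  at : ∀ u v → Dec (Σ (u < v) λ p → Σ (Adj G u v) λ a → P (edge u v p a))
  at u v with u <? v | T? (SimpleGraph.adj G u v)
  ... | no u≮v | _     = no λ { (p , _) → u≮v p }
  ... | yes _  | no ¬a = no λ { (_ , a , _) → ¬a a }
  ... | yes p  | yes a =
    map′ (λ Pe → p , a , Pe)
         (λ { (_ , _ , Pe) → subst P (edge-≡ refl refl) Pe })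
         (P? (edge u v p a))

usedColors : Coloring G k → Subset k
usedColors c = tabulate λ a → does (anyEdge? λ e → c e ≟ a)

#colors : Coloring G k → ℕ
#colors c = ∣ usedColors c ∣

-- m is the maximum of #colors over MD-colorings with palettes of every size.
MD≡ : SimpleGraph n → ℕ → Set
MD≡ G m =
  (∃[ k ] Σ (Coloring G k) λ c → IsMDColoring G c × #colors c ≡ m) ×
  (∀ k (c : Coloring G k) → IsMDColoring G c → #colors c ℕ.≤ m)

-- From here to md≡1?: decidability of the event, so that graphs can be counted.

∈-used⁺ : (c : Coloring G k) → ∀ e → c e ∈ usedColors c
∈-used⁺ c e = lookup⇒[]= _ _
  (trans (lookup∘tabulate _ (c e)) (dec-true (anyEdge? _) (e , refl)))

∈-used⁻ : (c : Coloring G k) → ∀ {a} → a ∈ usedColors c → ∃[ e ] c e ≡ a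
∈-used⁻ c {a} a∈ =
  witness (anyEdge? _) (trans (sym (lookup∘tabulate _ a)) ([]=⇒lookup a∈))
  where
  witness : {A : Set} (a? : Dec A) → does a? ≡ true → A
  witness (yes x) _ = x

module Reachability {R : Rel (Fin n) 0ℓ} (R? : Decidable R) where

  -- Walks whose intermediate vertices are restricted to a list (Warshall).
  Via : List (Fin n) → Rel (Fin n) 0ℓ
  Via []       u v = u ≡ v ⊎ R u v
  Via (x ∷ xs) u v = Via xs u v ⊎ (Via xs u x × Via xs x v)

  via? : ∀ xs → Decidable (Via xs)
  via? []       u v = (u ≟ v) ⊎-dec R? u v
  via? (x ∷ xs) u v = via? xs u v ⊎-dec (via? xs u x ×-dec via? xs x v)

  via⇒star : ∀ xs {u v} → Via xs u v → Star R u v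
  via⇒star []       (inj₁ refl)    = ε
  via⇒star []       (inj₂ r)       = r ◅ ε
  via⇒star (x ∷ xs) (inj₁ p)       = via⇒star xs p
  via⇒star (x ∷ xs) (inj₂ (p , q)) = via⇒star xs p ◅◅ via⇒star xs q

  via-base : ∀ xs {u v} → u ≡ v ⊎ R u v → Via xs u v
  via-base []       p = p
  via-base (x ∷ xs) p = inj₁ (via-base xs p)

  via-trans : ∀ {xs w u v} → w ∈ˡ xs → Via xs u w → Via xs w v → Via xs u v
  via-trans {x ∷ xs} (here refl) p q = inj₂ (to p , from q)
    where
    to : ∀ {u} → Via (x ∷ xs) u x → Via xs u x
    to (inj₁ p)       = p
    to (inj₂ (p , _)) = p
    from : ∀ {v} → Via (x ∷ xs) x v → Via xs x v
    from (inj₁ q)       = q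
    from (inj₂ (_ , q)) = q
  via-trans (there i) (inj₁ p)        (inj₁ q)        = inj₁ (via-trans i p q)
  via-trans (there i) (inj₁ p)        (inj₂ (q , q′)) = inj₂ (via-trans i p q , q′)
  via-trans (there i) (inj₂ (p , p′)) (inj₁ q)        = inj₂ (p , via-trans i p′ q)
  via-trans (there i) (inj₂ (p , _))  (inj₂ (_ , q′)) = inj₂ (p , q′)

  star⇒via : ∀ {u v} → Star R u v → Via (allFin n) u v
  star⇒via ε        = via-base (allFin n) (inj₁ refl)
  star⇒via (r ◅ rs) =
    via-trans (∈-allFin _) (via-base (allFin n) (inj₂ r)) (star⇒via rs)

  star? : Decidable (Star R)
  star? u v = map′ (via⇒star (allFin n)) star⇒via (via? (allFin n) u v)

connected? : (G : SimpleGraph n) → Dec (Connected G)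
connected? G = all? λ u → all? λ v → star? u v
  where open Reachability (λ u v → T? (SimpleGraph.adj G u v))

joins? : (e : Edge G) → Decidable (Joins e)
joins? e u v = ((src e ≟ u) ×-dec (tgt e ≟ v)) ⊎-dec ((src e ≟ v) ×-dec (tgt e ≟ u))

separates? : (G : SimpleGraph n) (M : EdgeSet G) → Decidable (Separates G M)
separates? G M u v = ¬? (star? u v)
  where
  open Reachability {R = AdjAvoiding G M}
    (λ u v → anyEdge? λ e → joins? e u v ×-dec ¬? (T? (M e)))

separates-⊆ : {M N : EdgeSet G} → (∀ e → e ∈ᴱ M → e ∈ᴱ N) →
              ∀ {u v} → Separates G M u v → Separates G N u v
separates-⊆ M⊆N sep walk =
  sep (Star-map (λ { (e , j , e∉N) → e , j , e∉N ∘ M⊆N e }) walk)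

noEdges : EdgeSet G
noEdges _ = false

colorClass : Coloring G k → Edge G → EdgeSet G
colorClass c e f = does (c f ≟ c e)

∈-class⁺ : (c : Coloring G k) → ∀ {e f} → c f ≡ c e → f ∈ᴱ colorClass c e
∈-class⁺ c {e} {f} eq = subst T (sym (dec-true (c f ≟ c e) eq)) tt

∈-class⁻ : (c : Coloring G k) → ∀ {e f} → f ∈ᴱ colorClass c e → c f ≡ c e
∈-class⁻ c {e} {f} f∈ with c f ≟ c e
... | yes eq = eq

-- It suffices to test the empty set and the full color classes as cuts.
isMDColoring? : (G : SimpleGraph n) (c : Coloring G k) → Dec (IsMDColoring G c)
isMDColoring? G c = all? λ u → all? λ v → ¬? (u ≟ v) →-dec cut? u v
  where
  cut? : ∀ u v → Dec (Σ (EdgeSet G) λ M → Monochromatic c M × Separates G M u v)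
  cut? u v =
    map′ to from (separates? G noEdges u v ⊎-dec
                  anyEdge? λ e → separates? G (colorClass c e) u v)
    where
    to : Separates G noEdges u v ⊎ (∃[ e ] Separates G (colorClass c e) u v) →
         Σ (EdgeSet G) λ M → Monochromatic c M × Separates G M u v
    to (inj₁ sep)       = noEdges , (λ _ _ ()) , sep
    to (inj₂ (e , sep)) =
      colorClass c e ,
      (λ _ _ f∈ g∈ → trans (∈-class⁻ c f∈) (sym (∈-class⁻ c g∈))) ,
      sep
    from : (Σ (EdgeSet G) λ M → Monochromatic c M × Separates G M u v) →
           Separates G noEdges u v ⊎ (∃[ e ] Separates G (colorClass c e) u v)
    from (M , mono , sep) with anyEdge? (λ e → T? (M e))
    ... | yes (e , e∈M) =
      inj₂ (e , separates-⊆ (λ f f∈M → ∈-class⁺ c (mono f e f∈M e∈M)) sep)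
    ... | no ∄e = inj₁ (separates-⊆ (λ e e∈M → ⊥-elim (∄e (e , e∈M))) sep)

isMDColoring-coarsen : {G : SimpleGraph n} {c : Coloring G k} {d : Coloring G m} →
                       (∀ e f → c e ≡ c f → d e ≡ d f) →
                       IsMDColoring G c → IsMDColoring G d
isMDColoring-coarsen coarser md u v u≢v =
  let M , mono , sep = md u v u≢v
  in  M , (λ e f e∈M f∈M → coarser e f (mono e f e∈M f∈M)) , sep

edgeSetOf : {G : SimpleGraph n} → Subset (n ℕ.* n) → EdgeSet G
edgeSetOf S e = lookup S (combine (src e) (tgt e))

edgeSetOf-surjective : {G : SimpleGraph n} (M : EdgeSet G) → ∃[ S ] (∀ e → edgeSetOf S e ≡ M e)
edgeSetOf-surjective {n = n} {G = G} M = tabulate (does ∘ in?) , agrees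
  where
  In : Fin (n ℕ.* n) → Set
  In i = Σ (Edge G) λ e → combine (src e) (tgt e) ≡ i × e ∈ᴱ M
  in? : ∀ i → Dec (In i)
  in? i = anyEdge? λ e → (combine (src e) (tgt e) ≟ i) ×-dec T? (M e)
  agrees′ : ∀ e → does (in? (combine (src e) (tgt e))) ≡ M e
  agrees′ e with T? (M e)
  ... | yes e∈M = trans (dec-true (in? _) (e , refl , e∈M)) (sym (T-true e∈M))
    where
    T-true : ∀ {b} → T b → b ≡ true
    T-true {true} _ = refl
  ... | no e∉M = trans (dec-false (in? _) out) (sym (T-false e∉M))
    where
    T-false : ∀ {b} → ¬ T b → b ≡ false
    T-false {true}  ¬t = ⊥-elim (¬t tt)
    T-false {false} _  = refl
    out : ¬ In (combine (src e) (tgt e))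
    out (f , same , f∈M) =
      let src≡ , tgt≡ = combine-injective (src f) (tgt f) (src e) (tgt e) same
      in  e∉M (subst (_∈ᴱ M) (edge-≡ src≡ tgt≡) f∈M)
  agrees : ∀ e → edgeSetOf (tabulate (does ∘ in?)) e ≡ M e
  agrees e = trans (lookup∘tabulate (does ∘ in?) _) (agrees′ e)

-- Merging colors keeps a coloring MD, so md(G) ≥ 2 iff some 2-coloring of
-- this form is MD and nonconstant.
twoColoring : EdgeSet G → Coloring G 2
twoColoring M e = if M e then zero else suc zero

NonConstant : Coloring G k → Set
NonConstant {G = G} c = Σ (Edge G) λ e → Σ (Edge G) λ f → c e ≢ c f

Bichromatic : SimpleGraph n → Set
Bichromatic {n} G = ∃[ S ] (IsMDColoring G (c S) × NonConstant (c S))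
  where
  c : Subset (n ℕ.* n) → Coloring G 2
  c S = twoColoring (edgeSetOf S)

bichromatic? : (G : SimpleGraph n) → Dec (Bichromatic G)
bichromatic? G = anySubset? λ S →
  isMDColoring? G (twoColoring (edgeSetOf S)) ×-dec
  anyEdge? λ e → anyEdge? λ f → ¬? (_ ≟ _)

bichromatic⁺ : {G : SimpleGraph n} (c : Coloring G k) →
               IsMDColoring G c → NonConstant c → Bichromatic G
bichromatic⁺ {G = G} c md (e , f , ce≢cf) =
  S , isMDColoring-coarsen coarser md , e , f , distinct
  where
  M : EdgeSet G
  M g = does (c g ≟ c e)
  S = proj₁ (edgeSetOf-surjective M)
  S≗M = proj₂ (edgeSetOf-surjective M)
  coarser : ∀ g h → c g ≡ c h →
            twoColoring {G = G} (edgeSetOf S) g ≡ twoColoring (edgeSetOf S) h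
  coarser g h eq rewrite S≗M g | S≗M h | eq = refl
  distinct : twoColoring {G = G} (edgeSetOf S) e ≢ twoColoring (edgeSetOf S) f
  distinct eq
    rewrite S≗M e | S≗M f
          | dec-true (c e ≟ c e) refl
          | dec-false (c f ≟ c e) (ce≢cf ∘ sym)
    = contradiction eq λ ()

#colors≥1 : (c : Coloring G k) → Edge G → 1 ℕ.≤ #colors c
#colors≥1 c e = subst (ℕ._≤ #colors c) (∣⁅x⁆∣≡1 (c e))
  (p⊆q⇒∣p∣≤∣q∣ λ a∈ → subst (_∈ usedColors c) (sym (x∈⁅y⁆⇒x≡y _ a∈)) (∈-used⁺ c e))

#colors≥2 : (c : Coloring G k) → NonConstant c → 2 ℕ.≤ #colors c
#colors≥2 c (e , f , ce≢cf) = ℕ.≤-<-trans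
  (subst (ℕ._≤ ∣ usedColors c - c f ∣) (∣⁅x⁆∣≡1 (c e))
    (p⊆q⇒∣p∣≤∣q∣ λ a∈ → subst (_∈ (usedColors c - c f)) (sym (x∈⁅y⁆⇒x≡y _ a∈))
      (x∈p∧x≢y⇒x∈p-y (∈-used⁺ c e) ce≢cf)))
  (x∈p⇒∣p-x∣<∣p∣ (∈-used⁺ c f))

#colors≤1 : (c : Coloring G k) → ¬ NonConstant c → #colors c ℕ.≤ 1
#colors≤1 {k = k} c const with nonempty? (usedColors c)
... | no empty = subst (ℕ._≤ 1)
                   (sym (trans (cong ∣_∣ (Empty-unique empty)) (∣⊥∣≡0 k))) ℕ.z≤n
... | yes (a , a∈) = subst (∣ usedColors c ∣ ℕ.≤_) (∣⁅x⁆∣≡1 a) (p⊆q⇒∣p∣≤∣q∣ only-a)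
  where
  only-a : usedColors c ⊆ ⁅ a ⁆
  only-a {b} b∈ with b ≟ a
  ... | yes refl = x∈⁅x⁆ a
  ... | no b≢a =
    let e , ce≡b = ∈-used⁻ c b∈
        f , cf≡a = ∈-used⁻ c a∈
    in  contradiction (e , f , λ ce≡cf → b≢a (trans (sym ce≡b) (trans ce≡cf cf≡a))) const

#colors≡1⇒edge : (c : Coloring G k) → #colors c ≡ 1 → Edge G
#colors≡1⇒edge {k = k} c #≡1 with nonempty? (usedColors c)
... | yes (a , a∈) = proj₁ (∈-used⁻ c a∈)
... | no empty =
  contradiction (trans (sym #≡1) (trans (cong ∣_∣ (Empty-unique empty)) (∣⊥∣≡0 k))) λ ()

monochromatic-isMD : (G : SimpleGraph n) → IsMDColoring {k = 1} G (λ _ → zero)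
monochromatic-isMD G u v u≢v = (λ _ → true) , (λ _ _ _ _ → refl) , sep
  where
  sep : Separates G (λ _ → true) u v
  sep ε                  = u≢v refl
  sep ((_ , _ , e∉) ◅ _) = e∉ tt

md≡1? : (G : SimpleGraph n) → Dec (MD≡ G 1)
md≡1? G with anyEdge? {G = G} (λ _ → yes tt) | bichromatic? G
... | no ∄e | _ = no λ { ((_ , c , _ , #≡1) , _) → ∄e (#colors≡1⇒edge c #≡1 , tt) }
... | yes _ | yes (S , md , nc) = no λ { (_ , max) →
  ℕ.<⇒≱ (#colors≥2 (twoColoring (edgeSetOf S)) nc) (max 2 (twoColoring (edgeSetOf S)) md) }
... | yes (e , _) | no ¬bi = yes
  ( (1 , (λ _ → zero) , monochromatic-isMD G
    , ℕ.≤-antisym (#colors≤1 {G = G} {k = 1} (λ _ → zero) λ { (_ , _ , z≢z) → z≢z refl })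
                  (#colors≥1 {k = 1} (λ _ → zero) e))
  , λ k c md → #colors≤1 c (λ nc → ¬bi (bichromatic⁺ c md nc)) )

-- One coin per pair of vertices: in  r ∷ ω  the row r holds the coins for the
-- pairs {zero , suc v}, and ω holds those for the pairs {suc u , suc v}.
data Coins : ℕ → Set where
  []  : Coins 0
  _∷_ : Vec Bool n → Coins n → Coins (ℕ.suc n)

coinAdj : Coins n → Fin n → Fin n → Bool
coinAdj (r ∷ ω) zero    zero    = false
coinAdj (r ∷ ω) zero    (suc v) = lookup r v
coinAdj (r ∷ ω) (suc u) zero    = lookup r u
coinAdj (r ∷ ω) (suc u) (suc v) = coinAdj ω u v

coinAdj-sym : (ω : Coins n) → ∀ u v → coinAdj ω u v ≡ coinAdj ω v u
coinAdj-sym (r ∷ ω) zero    zero    = refl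
coinAdj-sym (r ∷ ω) zero    (suc v) = refl
coinAdj-sym (r ∷ ω) (suc u) zero    = refl
coinAdj-sym (r ∷ ω) (suc u) (suc v) = coinAdj-sym ω u v

coinAdj-irrefl : (ω : Coins n) → ∀ u → coinAdj ω u u ≡ false
coinAdj-irrefl (r ∷ ω) zero    = refl
coinAdj-irrefl (r ∷ ω) (suc u) = coinAdj-irrefl ω u

toGraph : Coins n → SimpleGraph n
toGraph ω = record
  { adj        = coinAdj ω
  ; adj-sym    = coinAdj-sym ω
  ; adj-irrefl = coinAdj-irrefl ω
  }

allRows : ∀ n → List (Vec Bool n)
allRows 0         = [ [] ]
allRows (ℕ.suc n) = cartesianProductWith _∷_ (true ∷ false ∷ []) (allRows n)

allCoins : ∀ n → List (Coins n)
allCoins 0         = [ [] ]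
allCoins (ℕ.suc n) = cartesianProductWith _∷_ (allRows n) (allCoins n)

product-nonZero : {A B C : Set} (f : A → B → C) (xs : List A) (ys : List B) →
                  NonZero (length xs) → NonZero (length ys) →
                  NonZero (length (cartesianProductWith f xs ys))
product-nonZero f (_ ∷ _) (_ ∷ _) _ _ = _

allRows-nonZero : ∀ n → NonZero (length (allRows n))
allRows-nonZero 0         = _
allRows-nonZero (ℕ.suc n) =
  product-nonZero _∷_ (true ∷ false ∷ []) (allRows n) _ (allRows-nonZero n)

allCoins-nonZero : ∀ n → NonZero (length (allCoins n))
allCoins-nonZero 0         = _
allCoins-nonZero (ℕ.suc n) =
  product-nonZero _∷_ (allRows n) (allCoins n) (allRows-nonZero n) (allCoins-nonZero n)

-- Independent fair coins are uniform on Coins n, so the probability of an event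
-- is the proportion of outcomes in it.
Pr : ∀ n (P : SimpleGraph n → Set) → (∀ G → Dec (P G)) → ℚ
Pr n P P? =
  _/_ (+ length (filter (P? ∘ toGraph) (allCoins n))) (length (allCoins n))
      {{allCoins-nonZero n}}

TendsTo : (ℕ → ℚ) → ℚ → Set
TendsTo p l = ∀ ε → 0ℚ ℚ.< ε → ∃[ N ] (∀ n → N ℕ.≤ n → ℚ.∣ p n ℚ.- l ∣ ℚ.< ε)

{-# OPTIONS --safe #-}

-- If every three vertices u, v, w have a common neighbor, then md = 1: in an
-- MD-coloring any two edges of a triangle have the same color, hence edges uv and
-- uw agree with the edge ux for a common neighbor x of u, v, w, and such moves
-- reach every edge from every other.  For fixed u, v, w, each further vertex is a
-- common neighbor with probability at least 1/8, whatever the status of the rest: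
-- forcing its three coins is an at most 8-to-1 map that does not affect which of
-- the others are common neighbors.  A union bound then gives failure probability
-- at most n³ (7/8)ⁿ⁻³.
module Submission where

open import Data.Nat.Base using (ℕ)
open import Data.Product.Base using (_×_)
open import Data.Rational.Base using (1ℚ)
open import Relation.Nullary.Decidable using (_×-dec_)
open import Defs

open import Algebra.Properties.CommutativeSemigroup using (interchange; x∙yz≈y∙xz; x∙yz≈yx∙z; xy∙z≈y∙xz)
open import Data.Bool.Base using (Bool; true; false; T; _∧_)
open import Data.Empty using (⊥-elim)
open import Data.Fin.Base using (Fin; zero; suc; fromℕ<)
open import Data.Fin.Properties using (<-cmp) renaming (_≟_ to _≟ᶠ_)
open import Data.Integer.Base as ℤ using (+[1+_]; -[1+_])
import Data.Integer.Properties as ℤ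
open import Data.List.Base
  using (List; []; _∷_; _++_; map; length; filter; take; allFin; cartesianProduct; cartesianProductWith)
open import Data.List.Membership.Propositional using () renaming (_∈_ to _∈ˡ_; _∉_ to _∉ˡ_)
open import Data.List.Membership.Propositional.Properties using (∈-allFin; ∈-cartesianProduct⁺)
open import Data.List.Properties using (length-take; length-tabulate; filter-all)
open import Data.List.Relation.Unary.All as All using (All; []; _∷_)
import Data.List.Relation.Unary.All.Properties as All
open import Data.List.Relation.Unary.AllPairs using ([]; _∷_)
open import Data.List.Relation.Unary.Any using (here; there)
open import Data.List.Relation.Unary.Unique.Propositional using (Unique)
import Data.List.Relation.Unary.Unique.Propositional.Properties as Unique
open import Data.Nat.Base
  using (zero; suc; _+_; _*_; _∸_; _^_; _≤_; _<_; z≤n; s≤s; NonZero; >-nonZero)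
open import Data.Nat.Properties hiding (<-cmp)
open import Data.Nat.Solver using (module +-*-Solver)
open import Data.Product.Base using (Σ; ∃-syntax; _,_; proj₁)
open import Data.Rational.Base as ℚ using (mkℚ; 0ℚ; _/_; *<*)
import Data.Rational.Properties as ℚ
open import Data.Rational.Unnormalised.Base as ℚᵘ using (mkℚᵘ)
import Data.Rational.Unnormalised.Properties as ℚᵘ
open import Data.Sum.Base using (_⊎_; inj₁; inj₂)
open import Data.Unit.Base using (tt)
open import Data.Vec.Base using (Vec; []; _∷_; lookup; _[_]≔_)
open import Data.Vec.Properties using (lookup∘update; lookup∘update′)
open import Function.Base using (_∘_)
open import Relation.Binary.Construct.Closure.ReflexiveTransitive using (ε; _◅_)
open import Relation.Binary.Definitions using (tri<; tri≈; tri>)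
open import Relation.Binary.PropositionalEquality
  using (_≡_; _≢_; refl; sym; trans; cong; cong₂; subst; module ≡-Reasoning)
open import Relation.Nullary.Decidable using (Dec; yes; no; ¬?; T?)
open import Relation.Nullary.Negation using (¬_)

private variable
  n k : ℕ
  A B C : Set

-- Triangles and MD-colorings

-- The three vertices may coincide; degenerate triples yield connectedness and the existence of an
-- edge. The common neighbor differs from all three because adjacency is irreflexive.
TriplesDominated : SimpleGraph n → Set
TriplesDominated G = ∀ u v w → ∃[ x ] (Adj G u x × Adj G v x × Adj G w x)

module _ {G : SimpleGraph n} where

  adj-swap : ∀ {u v} → Adj G u v → Adj G v u
  adj-swap {u} {v} = subst T (SimpleGraph.adj-sym G u v)

  edgeJoining : ∀ {u v} → Adj G u v → Σ (Edge G) λ e → Joins e u v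
  edgeJoining {u} {v} a with <-cmp u v
  ... | tri< u<v _ _ = edge u v u<v a , inj₁ (refl , refl)
  ... | tri≈ _ refl _ = ⊥-elim (subst T (SimpleGraph.adj-irrefl G u) a)
  ... | tri> _ _ v<u = edge v u v<u (adj-swap a) , inj₂ (refl , refl)

  joins-swap : ∀ (e : Edge G) {u v} → Joins e u v → Joins e v u
  joins-swap _ (inj₁ p) = inj₂ p
  joins-swap _ (inj₂ p) = inj₁ p

  joins⇒≢ : ∀ (e : Edge G) {u v} → Joins e u v → u ≢ v
  joins⇒≢ e (inj₁ (refl , refl)) u≡v =
    subst T (SimpleGraph.adj-irrefl G _) (subst (Adj G _) (sym u≡v) (adjacent e))
  joins⇒≢ e (inj₂ (refl , refl)) u≡v =
    subst T (SimpleGraph.adj-irrefl G _) (subst (Adj G _) u≡v (adjacent e))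

  module _ {c : Coloring G k} (md : IsMDColoring G c) where

    -- A cut separating u from v contains uv and meets every path u, x, v.
    triangle-repeats : ∀ (e f g : Edge G) {u v x} →
                       Joins e u v → Joins f u x → Joins g x v →
                       c e ≡ c f ⊎ c e ≡ c g
    triangle-repeats e f g {u} {v} e-uv f-ux g-xv
      with md u v (joins⇒≢ e e-uv)
    ... | M , mono , sep with T? (M e) | T? (M f) | T? (M g)
    ... | no e∉ | _      | _      = ⊥-elim (sep ((e , e-uv , e∉) ◅ ε))
    ... | yes e∈ | yes f∈ | _      = inj₁ (mono e f e∈ f∈)
    ... | yes e∈ | no _   | yes g∈ = inj₂ (mono e g e∈ g∈)
    ... | yes e∈ | no f∉  | no g∉  =
      ⊥-elim (sep ((f , f-ux , f∉) ◅ (g , g-xv , g∉) ◅ ε))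

    -- Each of `e` and `f` repeats the color of another side of the triangle. Either one of them
    -- repeats the other, or both repeat `g`.
    triangle-mono : ∀ (e f g : Edge G) {u v w} →
                    Joins e u v → Joins f u w → Joins g v w → c e ≡ c f
    triangle-mono e f g e-uv f-uw g-vw
      with triangle-repeats e f g e-uv f-uw (joins-swap g g-vw)
         | triangle-repeats f e g f-uw e-uv g-vw
    ... | inj₁ ce≡cf | _          = ce≡cf
    ... | inj₂ _     | inj₁ cf≡ce = sym cf≡ce
    ... | inj₂ ce≡cg | inj₂ cf≡cg = trans ce≡cg (sym cf≡cg)

    -- For a common neighbor `x` of `u`, `v`, `w`, the triangles `uvx` and `uwx` share the edge
    -- `ux`, which has the color of both `e` and `f`.
    incident-same-color : TriplesDominated G → ∀ (e f : Edge G) {u v w} →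
                          Joins e u v → Joins f u w → c e ≡ c f
    incident-same-color dom e f {u} {v} {w} e-uv f-uw =
      let x , u~x , v~x , w~x = dom u v w
          h , h-ux = edgeJoining u~x
          g , g-vx = edgeJoining v~x
          l , l-wx = edgeJoining w~x
      in  trans (triangle-mono e h g e-uv h-ux g-vx) (sym (triangle-mono f h l f-uw h-ux l-wx))

    -- A common neighbor `x` of the two sources gives a chain of edges `e`, `h`, `l`, `f` in which
    -- consecutive ones meet, at `src e`, `x` and `src f`.
    constant-color : TriplesDominated G → ∀ e f → c e ≡ c f
    constant-color dom e f =
      let x , u~x , v~x , _ = dom (src e) (src f) (src f)
          h , h-ux = edgeJoining u~x
          l , l-vx = edgeJoining v~x
          at = incident-same-color dom
      in  trans (at e h (inj₁ (refl , refl)) h-ux)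
         (trans (at h l (joins-swap h h-ux) (joins-swap l l-vx))
                (at l f l-vx (inj₁ (refl , refl))))

  dominated⇒connected : TriplesDominated G → Connected G
  dominated⇒connected dom u v =
    let x , u~x , v~x , _ = dom u v v
    in  u~x ◅ adj-swap v~x ◅ ε

  -- The vertex argument excludes `n = 0`, where domination is vacuous but there is no edge to
  -- color. The triple `u`, `u`, `u` then supplies an edge.
  dominated⇒md≡1 : TriplesDominated G → Fin n → MD≡ G 1
  dominated⇒md≡1 dom u =
    let x , u~x , _ = dom u u u
        e , _ = edgeJoining u~x
        const = λ { (_ , _ , z≢z) → z≢z refl }
    in  (1 , (λ _ → zero) , monochromatic-isMD G ,
         ≤-antisym (#colors≤1 {G = G} {k = 1} (λ _ → zero) const)
                   (#colors≥1 {G = G} {k = 1} (λ _ → zero) e)) ,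
        λ _ c md → #colors≤1 c λ { (f , g , cf≢cg) → cf≢cg (constant-color md dom f g) }

-- Finite sums

∑ : List A → (A → ℕ) → ℕ
∑ []       f = 0
∑ (x ∷ xs) f = f x + ∑ xs f

∑-cong : ∀ {f g : A → ℕ} (xs : List A) → (∀ x → f x ≡ g x) → ∑ xs f ≡ ∑ xs g
∑-cong []       f≗g = refl
∑-cong (x ∷ xs) f≗g = cong₂ _+_ (f≗g x) (∑-cong xs f≗g)

∑-mono : ∀ {f g : A → ℕ} (xs : List A) → (∀ x → f x ≤ g x) → ∑ xs f ≤ ∑ xs g
∑-mono []       f≤g = z≤n
∑-mono (x ∷ xs) f≤g = +-mono-≤ (f≤g x) (∑-mono xs f≤g)

∑-+ : ∀ (xs : List A) (f g : A → ℕ) → ∑ xs (λ x → f x + g x) ≡ ∑ xs f + ∑ xs g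
∑-+ []       f g = refl
∑-+ (x ∷ xs) f g rewrite ∑-+ xs f g =
  interchange +-commutativeSemigroup (f x) (g x) (∑ xs f) (∑ xs g)

∑-* : ∀ c (xs : List A) (f : A → ℕ) → ∑ xs (λ x → c * f x) ≡ c * ∑ xs f
∑-* c []       f = sym (*-zeroʳ c)
∑-* c (x ∷ xs) f rewrite ∑-* c xs f = sym (*-distribˡ-+ c (f x) (∑ xs f))

∑-const : ∀ c (xs : List A) → ∑ xs (λ _ → c) ≡ length xs * c
∑-const c []       = refl
∑-const c (x ∷ xs) = cong (c +_) (∑-const c xs)

∑-swap : ∀ (xs : List A) (ys : List B) (f : A → B → ℕ) →
         ∑ xs (λ x → ∑ ys (f x)) ≡ ∑ ys (λ y → ∑ xs (λ x → f x y))
∑-swap []       ys f = sym (trans (∑-const 0 ys) (*-zeroʳ (length ys)))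
∑-swap (x ∷ xs) ys f =
  trans (cong (∑ ys (f x) +_) (∑-swap xs ys f)) (sym (∑-+ ys (f x) _))

∑-++ : ∀ (xs ys : List A) (f : A → ℕ) → ∑ (xs ++ ys) f ≡ ∑ xs f + ∑ ys f
∑-++ []       ys f = refl
∑-++ (x ∷ xs) ys f = trans (cong (f x +_) (∑-++ xs ys f)) (sym (+-assoc (f x) _ _))

∑-map : ∀ (g : A → B) (xs : List A) (f : B → ℕ) → ∑ (map g xs) f ≡ ∑ xs (f ∘ g)
∑-map g []       f = refl
∑-map g (x ∷ xs) f = cong (f (g x) +_) (∑-map g xs f)

∑-product : ∀ (g : A → B → C) xs ys (f : C → ℕ) →
            ∑ (cartesianProductWith g xs ys) f ≡ ∑ xs (λ x → ∑ ys (λ y → f (g x y)))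
∑-product g []       ys f = refl
∑-product g (x ∷ xs) ys f =
  trans (∑-++ (map (g x) ys) _ f) (cong₂ _+_ (∑-map (g x) ys f) (∑-product g xs ys f))

∑≡0⇒≡0 : ∀ {xs : List A} {f : A → ℕ} {x} → x ∈ˡ xs → ∑ xs f ≡ 0 → f x ≡ 0
∑≡0⇒≡0 {f = f} (here refl) s≡0 = m+n≡0⇒m≡0 (f _) s≡0
∑≡0⇒≡0 {xs = y ∷ _} {f} (there x∈) s≡0 = ∑≡0⇒≡0 x∈ (m+n≡0⇒n≡0 (f y) s≡0)

length-product : ∀ (g : A → B → C) xs ys →
                 length (cartesianProductWith g xs ys) ≡ length xs * length ys
length-product g xs ys = begin
  length (cartesianProductWith g xs ys)             ≡⟨ length-∑ (cartesianProductWith g xs ys) ⟩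
  ∑ (cartesianProductWith g xs ys) (λ _ → 1)        ≡⟨ ∑-product g xs ys _ ⟩
  ∑ xs (λ _ → ∑ ys (λ _ → 1))                       ≡⟨ ∑-const _ xs ⟩
  length xs * ∑ ys (λ _ → 1)                        ≡⟨ cong (length xs *_) (length-∑ ys) ⟨
  length xs * length ys                             ∎
  where
  open ≡-Reasoning
  length-∑ : ∀ {D : Set} (zs : List D) → length zs ≡ ∑ zs (λ _ → 1)
  length-∑ zs = sym (trans (∑-const 1 zs) (*-identityʳ _))

-- Forcing coins

force : Fin n → Fin n → Coins n → Coins n
force zero    zero    ω       = ω
force zero    (suc v) (r ∷ ω) = (r [ v ]≔ true) ∷ ω
force (suc u) zero    (r ∷ ω) = (r [ u ]≔ true) ∷ ω
force (suc u) (suc v) (r ∷ ω) = r ∷ force u v ω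

force-adj : ∀ {u v : Fin n} → u ≢ v → ∀ ω → coinAdj (force u v ω) u v ≡ true
force-adj {u = zero}  {zero}  u≢v ω       = ⊥-elim (u≢v refl)
force-adj {u = zero}  {suc v} u≢v (r ∷ ω) = lookup∘update v r true
force-adj {u = suc u} {zero}  u≢v (r ∷ ω) = lookup∘update u r true
force-adj {u = suc u} {suc v} u≢v (r ∷ ω) = force-adj (u≢v ∘ cong suc) ω

-- Any coin that is forced belongs to a pair containing `x`, so it is not the coin of `v` and `y`,
-- whatever `u` is. This is the source of independence between different candidates for a common
-- neighbor.
force-other : ∀ {u x v y : Fin n} → x ≢ v → x ≢ y → ∀ ω →
              coinAdj (force u x ω) v y ≡ coinAdj ω v y
force-other {u = zero} {zero} _ _ ω = refl
force-other {u = zero} {suc x} {zero} {zero} _ _ (r ∷ ω) = refl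
force-other {u = zero} {suc x} {zero} {suc y} _ x≢y (r ∷ ω) =
  lookup∘update′ (λ y≡x → x≢y (cong suc (sym y≡x))) r true
force-other {u = zero} {suc x} {suc v} {zero} x≢v _ (r ∷ ω) =
  lookup∘update′ (λ v≡x → x≢v (cong suc (sym v≡x))) r true
force-other {u = zero} {suc x} {suc v} {suc y} _ _ (r ∷ ω) = refl
force-other {u = suc u} {zero} {zero} x≢v _ ω = ⊥-elim (x≢v refl)
force-other {u = suc u} {zero} {suc v} {zero} _ x≢y ω = ⊥-elim (x≢y refl)
force-other {u = suc u} {zero} {suc v} {suc y} _ _ (r ∷ ω) = refl
force-other {u = suc u} {suc x} {zero} {zero} _ _ (r ∷ ω) = refl
force-other {u = suc u} {suc x} {zero} {suc y} _ _ (r ∷ ω) = refl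
force-other {u = suc u} {suc x} {suc v} {zero} _ _ (r ∷ ω) = refl
force-other {u = suc u} {suc x} {suc v} {suc y} x≢v x≢y (r ∷ ω) =
  force-other {u = u} (x≢v ∘ cong suc) (x≢y ∘ cong suc) ω

update-mono : ∀ {m} (r : Vec Bool m) i j → lookup r j ≡ true → lookup (r [ i ]≔ true) j ≡ true
update-mono (_ ∷ r) zero    zero    _ = refl
update-mono (_ ∷ r) zero    (suc j) p = p
update-mono (_ ∷ r) (suc i) zero    p = p
update-mono (_ ∷ r) (suc i) (suc j) p = update-mono r i j p

-- Forcing only sets coins to `true`, so adjacencies obtained earlier survive later forcing, even if
-- the same coin is forced twice.
force-mono : ∀ (u x v y : Fin n) ω → coinAdj ω v y ≡ true → coinAdj (force u x ω) v y ≡ true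
force-mono zero    zero    v       y       ω       p = p
force-mono zero    (suc x) zero    (suc y) (r ∷ ω) p = update-mono r x y p
force-mono zero    (suc x) (suc v) zero    (r ∷ ω) p = update-mono r x v p
force-mono zero    (suc x) (suc v) (suc y) (r ∷ ω) p = p
force-mono (suc u) zero    zero    (suc y) (r ∷ ω) p = update-mono r u y p
force-mono (suc u) zero    (suc v) zero    (r ∷ ω) p = update-mono r u v p
force-mono (suc u) zero    (suc v) (suc y) (r ∷ ω) p = p
force-mono (suc u) (suc x) zero    (suc y) (r ∷ ω) p = p
force-mono (suc u) (suc x) (suc v) zero    (r ∷ ω) p = p
force-mono (suc u) (suc x) (suc v) (suc y) (r ∷ ω) p = force-mono u x v y ω p

-- Setting coin `i` to `true` maps the rows two-to-one onto those with `true` at `i`, so the left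
-- side is twice the sum of `f` over these rows. The other rows contribute nonnegatively on the
-- right.
∑-update : ∀ (i : Fin n) (f : Vec Bool n → ℕ) →
           ∑ (allRows n) (λ r → f (r [ i ]≔ true)) ≤ 2 * ∑ (allRows n) f
∑-update {suc n} zero f
  rewrite ∑-product _∷_ (true ∷ false ∷ []) (allRows n) f
        | ∑-product _∷_ (true ∷ false ∷ []) (allRows n) (λ r → f (r [ zero ]≔ true)) =
  *-monoʳ-≤ 2 (m≤m+n (∑ (allRows n) (λ r → f (true ∷ r))) _)
∑-update {suc n} (suc i) f
  rewrite ∑-product _∷_ (true ∷ false ∷ []) (allRows n) f
        | ∑-product _∷_ (true ∷ false ∷ []) (allRows n) (λ r → f (r [ suc i ]≔ true))
        | *-distribˡ-+ 2 (∑ (allRows n) (λ r → f (true ∷ r)))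
                         (∑ (allRows n) (λ r → f (false ∷ r)) + 0)
        | *-distribˡ-+ 2 (∑ (allRows n) (λ r → f (false ∷ r))) 0 =
  +-mono-≤ (∑-update i (f ∘ (true ∷_))) (+-mono-≤ (∑-update i (f ∘ (false ∷_))) z≤n)

∑-force : ∀ (u v : Fin n) (f : Coins n → ℕ) →
          ∑ (allCoins n) (f ∘ force u v) ≤ 2 * ∑ (allCoins n) f
-- On the diagonal there is no coin and `force` is the identity, so the factor 2 is slack.
∑-force zero zero f = m≤m+n _ _
∑-force {suc n} zero (suc v) f
  rewrite ∑-product _∷_ (allRows n) (allCoins n) f
        | ∑-product _∷_ (allRows n) (allCoins n) (f ∘ force zero (suc v)) =
  ∑-update v (λ r → ∑ (allCoins n) (λ ω → f (r ∷ ω)))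
∑-force {suc n} (suc u) zero f
  rewrite ∑-product _∷_ (allRows n) (allCoins n) f
        | ∑-product _∷_ (allRows n) (allCoins n) (f ∘ force (suc u) zero) =
  ∑-update u (λ r → ∑ (allCoins n) (λ ω → f (r ∷ ω)))
∑-force {suc n} (suc u) (suc v) f
  rewrite ∑-product _∷_ (allRows n) (allCoins n) f
        | ∑-product _∷_ (allRows n) (allCoins n) (f ∘ force (suc u) (suc v))
        | sym (∑-* 2 (allRows n) (λ r → ∑ (allCoins n) (λ ω → f (r ∷ ω)))) =
  ∑-mono (allRows n) λ r → ∑-force u v (f ∘ (r ∷_))

-- Common neighbors

isCommon : List (Fin n) → Fin n → Coins n → Bool
isCommon []       x ω = true
isCommon (u ∷ us) x ω = coinAdj ω u x ∧ isCommon us x ω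

forceCommon : List (Fin n) → Fin n → Coins n → Coins n
forceCommon []       x ω = ω
forceCommon (u ∷ us) x ω = force u x (forceCommon us x ω)

-- The indicator of the event that no vertex of the list is a common neighbor of us.
noneCommon : List (Fin n) → List (Fin n) → Coins n → ℕ
noneCommon us []       ω = 1
noneCommon us (x ∷ xs) ω with isCommon us x ω
... | true  = 0
... | false = noneCommon us xs ω

common∧none : List (Fin n) → Fin n → List (Fin n) → Coins n → ℕ
common∧none us x xs ω with isCommon us x ω
... | true  = noneCommon us xs ω
... | false = 0

isCommon-forced : ∀ {us : List (Fin n)} {x} → x ∉ˡ us → ∀ ω →
                  isCommon us x (forceCommon us x ω) ≡ true
isCommon-forced {us = []} x∉ ω = refl
isCommon-forced {us = u ∷ us} {x} x∉ ω =
  cong₂ _∧_ (force-adj (x∉ ∘ here ∘ sym) (forceCommon us x ω))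
            (persists us (isCommon-forced (x∉ ∘ there) ω))
  where
  persists : ∀ vs {ω′} → isCommon vs x ω′ ≡ true → isCommon vs x (force u x ω′) ≡ true
  persists []       p = refl
  persists (v ∷ vs) {ω′} p with coinAdj ω′ v x in v~x
  ... | true = cong₂ _∧_ (force-mono u x v x ω′ v~x) (persists vs p)

forceCommon-other : ∀ (us : List (Fin n)) {x v y} → x ≢ v → x ≢ y → ∀ ω →
                    coinAdj (forceCommon us x ω) v y ≡ coinAdj ω v y
forceCommon-other []       x≢v x≢y ω = refl
forceCommon-other (u ∷ us) x≢v x≢y ω =
  trans (force-other {u = u} x≢v x≢y (forceCommon us _ ω)) (forceCommon-other us x≢v x≢y ω)

isCommon-other : ∀ {us vs : List (Fin n)} {x y} → x ∉ˡ vs → x ≢ y → ∀ ω →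
                 isCommon vs y (forceCommon us x ω) ≡ isCommon vs y ω
isCommon-other {vs = []} x∉ x≢y ω = refl
isCommon-other {us = us} {v ∷ vs} x∉ x≢y ω =
  cong₂ _∧_ (forceCommon-other us (x∉ ∘ here) x≢y ω) (isCommon-other {us = us} (x∉ ∘ there) x≢y ω)

-- Whether `y` is a common neighbor of `us` depends only on the coins joining `y` to `us`. For `y`
-- in `xs` none of these involves `x`, which lies outside `us` and differs from `y`.
noneCommon-other : ∀ {us xs : List (Fin n)} {x} → x ∉ˡ us → All (x ≢_) xs → ∀ ω →
                   noneCommon us xs (forceCommon us x ω) ≡ noneCommon us xs ω
noneCommon-other x∉ [] ω = refl
noneCommon-other {us = us} {y ∷ xs} {x} x∉ (x≢y ∷ x≢xs) ω
  with isCommon us y (forceCommon us x ω) | isCommon us y ω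
     | isCommon-other {us = us} x∉ x≢y ω
... | true  | _ | refl = refl
... | false | _ | refl = noneCommon-other x∉ x≢xs ω

∑-forceCommon : ∀ (us : List (Fin n)) x (f : Coins n → ℕ) →
                ∑ (allCoins n) (f ∘ forceCommon us x) ≤ 2 ^ length us * ∑ (allCoins n) f
∑-forceCommon []       x f = ≤-reflexive (sym (+-identityʳ _))
∑-forceCommon {n} (u ∷ us) x f = begin
  ∑ (allCoins n) (f ∘ force u x ∘ forceCommon us x)    ≤⟨ ∑-forceCommon us x (f ∘ force u x) ⟩
  2 ^ length us * ∑ (allCoins n) (f ∘ force u x)       ≤⟨ *-monoʳ-≤ (2 ^ length us) (∑-force u x f) ⟩
  2 ^ length us * (2 * ∑ (allCoins n) f)               ≡⟨ *-assoc (2 ^ length us) 2 _ ⟨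
  2 ^ length us * 2 * ∑ (allCoins n) f                 ≡⟨ cong (_* ∑ (allCoins n) f) (*-comm (2 ^ length us) 2) ⟩
  2 ^ suc (length us) * ∑ (allCoins n) f               ∎
  where open ≤-Reasoning

-- Split the outcomes counted by `noneCommon us xs` into `a` where `x` is a common neighbor and `b`
-- where it is not. Forcing gives `a + b ≤ (d + 1) * a`, so `b ≤ d * a`, and adding `d * b` to both
-- sides finishes. Thus `x` fails with conditional probability at most `d / (d + 1)`.
noneCommon-step : ∀ {us xs : List (Fin n)} {x} → x ∉ˡ us → All (x ≢_) xs →
                  ∀ {d} → 2 ^ length us ≡ suc d →
                  suc d * ∑ (allCoins n) (noneCommon us (x ∷ xs)) ≤
                  d * ∑ (allCoins n) (noneCommon us xs)
noneCommon-step {n} {us} {xs} {x} x∉ x≢xs {d} K≡ =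
  subst (λ s → suc d * b ≤ d * s) (sym split) (begin
    b + d * b         ≤⟨ +-monoˡ-≤ (d * b) b≤ ⟩
    d * a + d * b     ≡⟨ *-distribˡ-+ d a b ⟨
    d * (a + b)       ∎)
  where
  open ≤-Reasoning
  a = ∑ (allCoins n) (common∧none us x xs)
  b = ∑ (allCoins n) (noneCommon us (x ∷ xs))

  split : ∑ (allCoins n) (noneCommon us xs) ≡ a + b
  split = trans (∑-cong (allCoins n) pointwise) (∑-+ (allCoins n) _ _)
    where
    pointwise : ∀ ω → noneCommon us xs ω ≡ common∧none us x xs ω + noneCommon us (x ∷ xs) ω
    pointwise ω with isCommon us x ω
    ... | true  = sym (+-identityʳ _)
    ... | false = refl

  -- Forcing makes `x` a common neighbor and leaves the status of `xs` unchanged, so it sends every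
  -- outcome counted by `a + b` to one counted by `a`.
  forced : ∀ ω → noneCommon us xs ω ≡ common∧none us x xs (forceCommon us x ω)
  forced ω rewrite isCommon-forced x∉ ω = sym (noneCommon-other x∉ x≢xs ω)

  b≤ : b ≤ d * a
  b≤ = +-cancelˡ-≤ a b (d * a) (begin
    a + b                                                     ≡⟨ split ⟨
    ∑ (allCoins n) (noneCommon us xs)                         ≡⟨ ∑-cong (allCoins n) forced ⟩
    ∑ (allCoins n) (common∧none us x xs ∘ forceCommon us x)   ≤⟨ ∑-forceCommon us x _ ⟩
    2 ^ length us * a                                         ≡⟨ cong (_* a) K≡ ⟩
    suc d * a                                                 ∎)

-- By `noneCommon-step` each vertex of `xs` contributes a factor `d / (d + 1)`; denominators are
-- cleared to stay in the naturals.
noneCommon-bound : ∀ {us xs : List (Fin n)} → Unique xs → All (_∉ˡ us) xs →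
                   ∀ {d} → 2 ^ length us ≡ suc d →
                   suc d ^ length xs * ∑ (allCoins n) (noneCommon us xs) ≤
                   d ^ length xs * length (allCoins n)
noneCommon-bound {n} [] [] K≡ =
  ≤-reflexive (cong (1 *_) (trans (∑-const 1 (allCoins n)) (*-identityʳ _)))
noneCommon-bound {n} {us} {x ∷ xs} (x≢xs ∷ uniq) (x∉ ∷ xs∉) {d} K≡ = begin
  suc d * suc d ^ l * S′      ≡⟨ xy∙z≈y∙xz *-commutativeSemigroup (suc d) (suc d ^ l) S′ ⟩
  suc d ^ l * (suc d * S′)    ≤⟨ *-monoʳ-≤ (suc d ^ l) (noneCommon-step x∉ x≢xs K≡) ⟩
  suc d ^ l * (d * S)         ≡⟨ x∙yz≈y∙xz *-commutativeSemigroup (suc d ^ l) d S ⟩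
  d * (suc d ^ l * S)         ≤⟨ *-monoʳ-≤ d (noneCommon-bound uniq xs∉ K≡) ⟩
  d * (d ^ l * N)             ≡⟨ *-assoc d (d ^ l) N ⟨
  d * d ^ l * N               ∎
  where
  open ≤-Reasoning
  l = length xs
  N = length (allCoins n)
  S′ = ∑ (allCoins n) (noneCommon us (x ∷ xs))
  S  = ∑ (allCoins n) (noneCommon us xs)

noneCommon≡0 : ∀ (us xs : List (Fin n)) {ω} → noneCommon us xs ω ≡ 0 →
               ∃[ x ] isCommon us x ω ≡ true
noneCommon≡0 us (x ∷ xs) {ω} eq with isCommon us x ω in common
... | true  = x , common
... | false = noneCommon≡0 us xs eq

-- Vertices outside a given list

delete-length : ∀ (u : Fin n) {xs} → Unique xs →
                length xs ≤ suc (length (filter (λ x → ¬? (x ≟ᶠ u)) xs))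
delete-length u [] = z≤n
delete-length u {x ∷ xs} (x≢xs ∷ uniq) with x ≟ᶠ u
-- By uniqueness no later entry equals `u`, so the filter keeps the whole tail and only one entry is
-- lost.
... | yes refl rewrite filter-all (λ y → ¬? (y ≟ᶠ x)) (All.map (λ x≢y → x≢y ∘ sym) x≢xs) = ≤-refl
... | no _     = s≤s (delete-length u uniq)

avoiding : ∀ (us : List (Fin n)) →
           ∃[ xs ] (Unique xs × All (_∉ˡ us) xs × n ≤ length us + length xs)
avoiding {n} [] =
  allFin n , Unique.allFin⁺ n , All.universal (λ _ ()) (allFin n) ,
  ≤-reflexive (sym (length-tabulate {n = n} (λ i → i)))
avoiding (u ∷ us) =
  let xs , uniq , xs∉ , n≤ = avoiding us
      ≢u? = λ x → ¬? (x ≟ᶠ u)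
  in  filter ≢u? xs , Unique.filter⁺ ≢u? uniq ,
      All.zipWith (λ { (x≢u , x∉us) → λ { (here x≡u) → x≢u x≡u ; (there x∈us) → x∉us x∈us } })
        (All.all-filter ≢u? xs , All.filter⁺ ≢u? xs∉) ,
      ≤-trans n≤ (≤-trans (+-monoʳ-≤ (length us) (delete-length u uniq))
                          (≤-reflexive (+-suc (length us) _)))

-- Truncation to `m` entries gives every triple, degenerate or not, the same number of candidates,
-- so that all the bounds share the exponent `m`.
avoiding-exactly : ∀ (us : List (Fin n)) m → length us + m ≤ n →
                   ∃[ xs ] (Unique xs × All (_∉ˡ us) xs × length xs ≡ m)
avoiding-exactly us m m≤ =
  let xs , uniq , xs∉ , n≤ = avoiding us
  in  take m xs , Unique.take⁺ m uniq , All.take⁺ m xs∉ ,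
      trans (length-take m xs) (m≤n⇒m⊓n≡m (+-cancelˡ-≤ (length us) m _ (≤-trans m≤ n≤)))

-- The union bound

module Triples {n m} (3+m≤n : 3 + m ≤ n) where

  Triple : Set
  Triple = Fin n × Fin n × Fin n

  triples : List Triple
  triples = cartesianProduct (allFin n) (cartesianProduct (allFin n) (allFin n))

  vertices : Triple → List (Fin n)
  vertices (u , v , w) = u ∷ v ∷ w ∷ []

  witnesses : ∀ t → ∃[ xs ] (Unique xs × All (_∉ˡ vertices t) xs × length xs ≡ m)
  witnesses t = avoiding-exactly (vertices t) m 3+m≤n

  -- Only the `m` chosen candidates are tested: value 0 guarantees a common neighbor, while value 1
  -- may still leave one among the other vertices. Summing over triples therefore overcounts
  -- failures, as an upper bound permits.
  undominated : Triple → Coins n → ℕ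
  undominated t = noneCommon (vertices t) (proj₁ (witnesses t))

  undominated-bound : ∀ t → 8 ^ m * ∑ (allCoins n) (undominated t) ≤ 7 ^ m * length (allCoins n)
  undominated-bound t =
    let xs , uniq , xs∉ , length≡m = witnesses t
    in  subst (λ l → 8 ^ l * ∑ (allCoins n) (noneCommon (vertices t) xs) ≤ 7 ^ l * length (allCoins n))
          -- Here `refl` proves `2 ^ 3 ≡ suc 7`: three coins per candidate give the ratio 7/8.
          length≡m (noneCommon-bound uniq xs∉ refl)

  length-triples : length triples ≡ n * (n * n)
  length-triples = trans (length-product _,_ (allFin n) _)
    (cong₂ _*_ length-allFin (trans (length-product _,_ (allFin n) _) (cong₂ _*_ length-allFin length-allFin)))
    where
    length-allFin : length (allFin n) ≡ n
    length-allFin = length-tabulate {n = n} (λ i → i)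

  union-bound : 8 ^ m * ∑ (allCoins n) (λ ω → ∑ triples (λ t → undominated t ω)) ≤
                n * (n * n) * (7 ^ m * length (allCoins n))
  union-bound = begin
    8 ^ m * ∑ (allCoins n) (λ ω → ∑ triples (λ t → undominated t ω))
      ≡⟨ cong (8 ^ m *_) (∑-swap (allCoins n) triples _) ⟩
    8 ^ m * ∑ triples (λ t → ∑ (allCoins n) (undominated t))
      ≡⟨ ∑-* (8 ^ m) triples _ ⟨
    ∑ triples (λ t → 8 ^ m * ∑ (allCoins n) (undominated t))
      ≤⟨ ∑-mono triples undominated-bound ⟩
    ∑ triples (λ _ → 7 ^ m * length (allCoins n))
      ≡⟨ ∑-const _ triples ⟩
    length triples * (7 ^ m * length (allCoins n))
      ≡⟨ cong (_* (7 ^ m * length (allCoins n))) length-triples ⟩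
    n * (n * n) * (7 ^ m * length (allCoins n)) ∎
    where open ≤-Reasoning

  dominated : ∀ ω → ∑ triples (λ t → undominated t ω) ≡ 0 → TriplesDominated (toGraph ω)
  dominated ω s≡0 u v w
    with noneCommon≡0 (vertices (u , v , w)) (proj₁ (witnesses (u , v , w)))
           (∑≡0⇒≡0 {xs = triples} {f = λ t → undominated t ω}
             (∈-cartesianProduct⁺ (∈-allFin u) (∈-cartesianProduct⁺ (∈-allFin v) (∈-allFin w))) s≡0)
  ... | x , common with coinAdj ω u x in u~x | coinAdj ω v x in v~x | coinAdj ω w x in w~x
  ... | true | true | true = x , to u~x , to v~x , to w~x
    where
    to : ∀ {b} → b ≡ true → T b
    to refl = tt

length-complement : ∀ {P : A → Set} (P? : ∀ x → Dec (P x)) (xs : List A) →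
                    length (filter P? xs) + length (filter (¬? ∘ P?) xs) ≡ length xs
length-complement P? []       = refl
length-complement P? (x ∷ xs) with P? x
... | yes _ = cong suc (length-complement P? xs)
... | no _  = trans (+-suc _ _) (cong suc (length-complement P? xs))

-- Markov's inequality in counting form: `f` takes natural values, so it is at least 1 wherever `P`
-- holds.
length-filter-≤-∑ : ∀ {P : A → Set} (P? : ∀ x → Dec (P x)) {f : A → ℕ} →
                    (∀ x → f x ≡ 0 → ¬ P x) → ∀ xs → length (filter P? xs) ≤ ∑ xs f
length-filter-≤-∑ P? f≡0⇒¬P []       = z≤n
length-filter-≤-∑ P? {f} f≡0⇒¬P (x ∷ xs) with P? x | f x in fx≡
... | no _   | k     = ≤-trans (length-filter-≤-∑ P? f≡0⇒¬P xs) (m≤n+m _ k)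
... | yes px | zero  = ⊥-elim (f≡0⇒¬P x fx≡ px)
... | yes px | suc k = s≤s (≤-trans (length-filter-≤-∑ P? f≡0⇒¬P xs) (m≤n+m _ k))

-- Exponential growth

-- 30 makes ((s + 1) / s)⁴ ≤ 8/7 for all s ≥ 30, which the induction step needs.
-- The constant c is kept abstract because Agda would unfold 30 ^ 4 * q into 810000 summands.
quartic-growth : ∀ {c} → 30 ^ 4 ≤ c → ∀ m → (m + 30) ^ 4 * 7 ^ m ≤ c * 8 ^ m
quartic-growth     30⁴≤c zero    = *-monoˡ-≤ 1 30⁴≤c
quartic-growth {c} 30⁴≤c (suc m) = begin
  (suc m + 30) ^ 4 * (7 * 7 ^ m)     ≡⟨ x∙yz≈yx∙z *-commutativeSemigroup ((suc m + 30) ^ 4) 7 (7 ^ m) ⟩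
  7 * (suc m + 30) ^ 4 * 7 ^ m       ≤⟨ *-monoˡ-≤ (7 ^ m) (m+n≤o⇒m≤o (7 * (suc m + 30) ^ 4) (≤-reflexive (sym (expand m)))) ⟩
  8 * (m + 30) ^ 4 * 7 ^ m           ≡⟨ *-assoc 8 ((m + 30) ^ 4) (7 ^ m) ⟩
  8 * ((m + 30) ^ 4 * 7 ^ m)         ≤⟨ *-monoʳ-≤ 8 (quartic-growth 30⁴≤c m) ⟩
  8 * (c * 8 ^ m)                    ≡⟨ x∙yz≈y∙xz *-commutativeSemigroup 8 c (8 ^ m) ⟩
  c * (8 * 8 ^ m)                    ∎
  where
  open ≤-Reasoning
  open +-*-Solver
  -- The last bracket is the difference of the two quartics. Its coefficients are all natural, so
  -- dropping it leaves an inequality.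
  expand : ∀ m → 8 * (m + 30) ^ 4 ≡
                 7 * (suc m + 30) ^ 4 + (m ^ 4 + 92 * m ^ 3 + 2838 * m ^ 2 + 29852 * m + 15353)
  expand = solve 1 (λ m →
    con 8 :* (m :+ con 30) :^ 4 :=
    con 7 :* (con 1 :+ m :+ con 30) :^ 4 :+
    (m :^ 4 :+ con 92 :* m :^ 3 :+ con 2838 :* m :^ 2 :+ con 29852 :* m :+ con 15353)) refl

-- The fourth power leaves one factor to spare over the cube: once `c * q ≤ m`, the spare factor
-- `t = m + 30` exceeds `c * q`, and `quartic-growth` bounds `t ^ 4 * 7 ^ m`.
cubic<exponential : ∀ {c} → 30 ^ 4 ≤ c → ∀ q →
                    ∃[ M ] ∀ m → M ≤ m → q * ((3 + m) * ((3 + m) * (3 + m))) * 7 ^ m < 8 ^ m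
cubic<exponential {c} 30⁴≤c q = c * q , λ m cq≤m → *-cancelˡ-< c _ _ (beyond m cq≤m)
  where
  open ≤-Reasoning
  beyond : ∀ m → c * q ≤ m → c * (q * ((3 + m) * ((3 + m) * (3 + m))) * 7 ^ m) < c * 8 ^ m
  beyond m cq≤m = begin-strict
    c * (q * (s * (s * s)) * 7 ^ m)    ≡⟨ regroup c q s (7 ^ m) ⟩
    c * q * (s * (s * s) * 7 ^ m)      ≤⟨ *-monoʳ-≤ (c * q) (*-monoˡ-≤ (7 ^ m) cube≤) ⟩
    c * q * (t ^ 3 * 7 ^ m)            <⟨ *-monoˡ-< (t ^ 3 * 7 ^ m) cq<t ⟩
    t * (t ^ 3 * 7 ^ m)                ≡⟨ *-assoc t (t ^ 3) (7 ^ m) ⟨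
    t ^ 4 * 7 ^ m                      ≤⟨ quartic-growth 30⁴≤c m ⟩
    c * 8 ^ m                          ∎
    where
    open +-*-Solver using (solve; _:=_; _:*_)
    s = 3 + m
    t = m + 30
    s≤t : s ≤ t
    s≤t = ≤-trans (≤-reflexive (+-comm 3 m)) (+-monoʳ-≤ m (m≤m+n 3 27))
    cube≤ : s * (s * s) ≤ t ^ 3
    cube≤ = *-mono-≤ s≤t (*-mono-≤ s≤t (≤-trans s≤t (≤-reflexive (sym (*-identityʳ t)))))
    cq<t : c * q < t
    cq<t = ≤-<-trans cq≤m (m<m+n m (s≤s z≤n))
    instance
      t≢0 : NonZero t
      t≢0 = >-nonZero (≤-<-trans z≤n cq<t)
      positive : NonZero (t ^ 3 * 7 ^ m)
      positive = m*n≢0 (t ^ 3) (7 ^ m) {{m^n≢0 t 3}} {{m^n≢0 7 m}}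
    regroup : ∀ c q s p → c * (q * (s * (s * s)) * p) ≡ c * q * (s * (s * s) * p)
    regroup = solve 4 (λ c q s p → c :* (q :* (s :* (s :* s)) :* p) := c :* q :* (s :* (s :* s) :* p)) refl

-- Convergence of the probabilities to 1

open import Data.Integer.Base using (+_)

-- The distance from `c / d` to 1 is `b / d`, which is below 1 over the denominator of `δ`; a
-- positive `δ` is at least that, its numerator being at least 1.
near-one : ∀ {c b d} .{{nz : NonZero d}} {δ} → c + b ≡ d → 0ℚ ℚ.< δ →
           ℚ.↧ₙ δ * b < d → ℚ.∣ + c / d ℚ.- 1ℚ ∣ ℚ.< δ
near-one {δ = mkℚ (+ 0) _ _} _ (*<* (ℤ.+<+ ())) _
near-one {δ = mkℚ -[1+ _ ] _ _} _ (*<* ()) _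
near-one {c} {b} {suc d} {δ@(mkℚ +[1+ p ] q-1 _)} c+b≡d _ qb<d =
  ℚ.toℚᵘ-cancel-< (ℚᵘ.<-respˡ-≃ (ℚᵘ.≃-sym distance) (ℚᵘ.*<* below))
  where
  -- Unnormalised rationals keep the numerator and denominator explicit, whereas `+ c / suc d` is
  -- reduced to lowest terms.
  frac = mkℚᵘ (+ c) d

  distance : ℚ.toℚᵘ ℚ.∣ + c / suc d ℚ.- 1ℚ ∣ ℚᵘ.≃ ℚᵘ.∣ frac ℚᵘ.- ℚᵘ.1ℚᵘ ∣
  distance = ℚᵘ.≃-trans (ℚ.toℚᵘ-homo-∣-∣ (+ c / suc d ℚ.- 1ℚ))
    (ℚᵘ.∣-∣-cong (ℚᵘ.≃-trans (ℚ.toℚᵘ-homo-+ (+ c / suc d) (ℚ.- 1ℚ))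
      (ℚᵘ.+-congˡ (ℚᵘ.- ℚᵘ.1ℚᵘ) (ℚ.toℚᵘ-fromℚᵘ frac))))

  numerator : + c ℤ.* + 1 ℤ.+ ℤ.-1ℤ ℤ.* + suc d ≡ ℤ.- + b
  numerator = begin
    + c ℤ.* + 1 ℤ.+ ℤ.-1ℤ ℤ.* + suc d   ≡⟨ cong₂ ℤ._+_ (ℤ.*-identityʳ (+ c)) (ℤ.-1*i≡-i (+ suc d)) ⟩
    + c ℤ.- + suc d                     ≡⟨ cong (λ e → + c ℤ.- + e) c+b≡d ⟨
    + c ℤ.- (+ c ℤ.+ + b)               ≡⟨ cong (ℤ._+_ (+ c)) (ℤ.neg-distrib-+ (+ c) (+ b)) ⟩
    + c ℤ.+ (ℤ.- + c ℤ.- + b)           ≡⟨ ℤ.+-assoc (+ c) (ℤ.- + c) (ℤ.- + b) ⟨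
    + c ℤ.- + c ℤ.- + b                 ≡⟨ cong (ℤ._- + b) (ℤ.+-inverseʳ (+ c)) ⟩
    ℤ.0ℤ ℤ.- + b                        ≡⟨ ℤ.+-identityˡ (ℤ.- + b) ⟩
    ℤ.- + b                             ∎
    where open ≡-Reasoning

  below : + ℤ.∣ + c ℤ.* + 1 ℤ.+ ℤ.-1ℤ ℤ.* + suc d ∣ ℤ.* + suc q-1 ℤ.< +[1+ p ] ℤ.* + suc (d * 1)
  below rewrite numerator | ℤ.∣-i∣≡∣i∣ (+ b) | *-identityʳ d | sym (ℤ.pos-* b (suc q-1)) =
    ℤ.+<+ (<-≤-trans (subst (_< suc d) (*-comm (suc q-1) b) qb<d) (m≤n*m (suc d) (suc p)))

theorem3p3 : TendsTo (λ n → Pr n (λ G → Connected G × MD≡ G 1) (λ G → connected? G ×-dec md≡1? G)) 1ℚ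
theorem3p3 δ 0<δ = finish (cubic<exponential {30 ^ 4} ≤-refl q)
  where
  q = ℚ.↧ₙ δ

  Good : SimpleGraph n → Set
  Good G = Connected G × MD≡ G 1

  good? : (G : SimpleGraph n) → Dec (Good G)
  good? G = connected? G ×-dec md≡1? G

  bad : ∀ n → List (Coins n)
  bad n = filter (¬? ∘ good? ∘ toGraph) (allCoins n)

  few-bad : ∀ {n m} → 3 + m ≤ n → q * (n * (n * n)) * 7 ^ m < 8 ^ m →
            q * length (bad n) < length (allCoins n)
  few-bad {n} {m} 3+m≤n cubic< = *-cancelˡ-< (8 ^ m) _ _ (begin-strict
    8 ^ m * (q * length (bad n))       ≤⟨ *-monoʳ-≤ (8 ^ m) (*-monoʳ-≤ q bad≤) ⟩
    8 ^ m * (q * S)                    ≡⟨ x∙yz≈y∙xz *-commutativeSemigroup (8 ^ m) q S ⟩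
    q * (8 ^ m * S)                    ≤⟨ *-monoʳ-≤ q union-bound ⟩
    q * (n * (n * n) * (7 ^ m * N))    ≡⟨ regroup q (n * (n * n)) (7 ^ m) N ⟩
    q * (n * (n * n)) * 7 ^ m * N      <⟨ *-monoˡ-< N {{allCoins-nonZero n}} cubic< ⟩
    8 ^ m * N                          ∎)
    where
    open ≤-Reasoning
    open Triples 3+m≤n
    open +-*-Solver using (solve; _:=_; _:*_)
    N = length (allCoins n)
    S = ∑ (allCoins n) (λ ω → ∑ triples (λ t → undominated t ω))
    bad≤ : length (bad n) ≤ S
    -- An outcome with no undominated triple is good, so each bad outcome contributes at least 1 to
    -- `S`. The required vertex exists because `n` is at least 3.
    bad≤ = length-filter-≤-∑ (¬? ∘ good? ∘ toGraph)
      (λ ω s≡0 ¬good → let dom = dominated ω s≡0 in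
        ¬good (dominated⇒connected {G = toGraph ω} dom ,
               dominated⇒md≡1 dom (fromℕ< (≤-trans (s≤s z≤n) 3+m≤n))))
      (allCoins n)
    regroup : ∀ q c p t → q * (c * (p * t)) ≡ q * c * p * t
    regroup = solve 4 (λ q c p t → q :* (c :* (p :* t)) := q :* c :* p :* t) refl

  finish : (∃[ M ] ∀ m → M ≤ m → q * ((3 + m) * ((3 + m) * (3 + m))) * 7 ^ m < 8 ^ m) →
           ∃[ M ] ∀ n → M ≤ n → ℚ.∣ Pr n Good good? ℚ.- 1ℚ ∣ ℚ.< δ
  finish (M , beats) = 3 + M , λ n 3+M≤n →
    -- The exponent is `m = n ∸ 3`, since a triple removes up to three vertices from the candidates;
    -- the threshold `3 + M` ensures `M ≤ n ∸ 3`.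
    let 3+m≡n = m+[n∸m]≡n (≤-trans (m≤m+n 3 M) 3+M≤n)
        cubic< = beats (n ∸ 3) (+-cancelˡ-≤ 3 M (n ∸ 3) (subst (3 + M ≤_) (sym 3+m≡n) 3+M≤n))
    in  near-one {{allCoins-nonZero n}}
          (length-complement (good? ∘ toGraph) (allCoins n)) 0<δ
          (few-bad (≤-reflexive 3+m≡n)
            (subst (λ k → q * (k * (k * k)) * 7 ^ (n ∸ 3) < 8 ^ (n ∸ 3)) 3+m≡n cubic<))
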